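{- Let $\operatorname{sm}$ and $\operatorname{cm}$ be the functions analytic near $0$ defined by $\operatorname{sm}'=\operatorname{cm}^2$, $\operatorname{cm}'=-\operatorname{sm}^2$, $\operatorname{sm}(0)=0$, $\operatorname{cm}(0)=1$. For a power series $f(u)=\sum_{\nu\ge0}a_\nu u^\nu/\nu!$ write $\int_0^\infty f(u)e^{ -u/x}\,du:=\sum_{\nu\ge0}a_\nu\,\nu!\,x^{\nu+1}$ (formal Laplace transform). For sequences $(a_n)_{n\ge1}$, $(b_n)_{n\ge0}$ and a monomial $N$, write $$J[N;a,b]:=\cfrac{N}{1+b_0x^3-\cfrac{a_1x^6}{1+b_1x^3-\cfrac{a_2x^6}{1+b_2x^3-\ddots}}}.$$ Then, as formal power series in $x$: (1) $\int_0^\infty \operatorname{sm}(u)e^{ -u/x}du=J[x^2;a,b]$ with $a_n=(3n-2)(3n-1)^2(3n)^2(3n+1)$, $b_n=2(3n+1)((3n+1)^2+1)$; (2) $\int_0^\infty \operatorname{sm}(u)^2e^{ -u/x}du=J[2x^3;a,b]$ with $a_n=(3n-1)(3n)^2(3n+1)^2(3n+2)$, $b_n=2(3n+2)((3n+2)^2+1)$; (3) $\int_0^\infty \operatorname{sm}(u)^3e^{ -u/x}du=J[6x^4;a,b]$ with $a_n=(3n)(3n+1)^2(3n+2)^2(3n+3)$, $b_n=2(3n+3)((3n+3)^2+1)$; (4) $\int_0^\infty \operatorname{cm}(u)e^{ -u/x}du=J[x;a,b]$ with $a_n=(3n-2)^2(3n-1)^2(3n)^2$, $b_n=(3n-1)(3n)^2+(3n+1)^2(3n+2)$;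 (5) $\int_0^\infty \operatorname{sm}(u)\operatorname{cm}(u)e^{ -u/x}du=J[x^2;a,b]$ with $a_n=(3n-1)^2(3n)^2(3n+1)^2$, $b_n=(3n)(3n+1)^2+(3n+2)^2(3n+3)$; (6) $\int_0^\infty \operatorname{sm}(u)^2\operatorname{cm}(u)e^{ -u/x}du=J[2x^3;a,b]$ with $a_n=(3n)^2(3n+1)^2(3n+2)^2$, $b_n=(3n+1)(3n+2)^2+(3n+3)^2(3n+4)$. (In each case $b_0$ is the value of the $b_n$ formula at $n=0$, namely $4,20,60,2,12,40$ respectively.)
   Context: The integrals denote the formal transformation from exponential to ordinary generating functions described in the claim; no analytic convergence is asserted. The continued fractions are understood as formal power series in $x$.
   Formalization: With f(u)=Σ a_ν u^ν/ν! the formal Laplace transform is taken as Σ a_ν x^{ν+1}; the factor ν! in the stated formula is dropped, since with it (1) fails (x^5 coefficient -96 instead of -4). -}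

module Defs where

open import Data.Nat using (ℕ; zero; suc; _≤_; _≤?_; _≡ᵇ_)
import Data.Nat as ℕ
open import Data.Nat.Combinatorics using (_C_)
open import Data.Integer using (ℤ; +_; _+_; _-_; _*_; -_)
open import Data.Bool using (if_then_else_)
open import Data.Product using (∃; _×_)
open import Relation.Nullary.Decidable using (does)
open import Relation.Binary.PropositionalEquality using (_≡_)

-- A formal power series with integer coefficients, given by its coefficient
-- sequence: (f n) is the coefficient of x^n (ordinary series) or, for an
-- exponential generating function, the value of the n-th derivative at 0.
Series : Set
Series = ℕ → ℤ

sumTo : ℕ → (ℕ → ℤ) → ℤ
sumTo zero    f = f 0
sumTo (suc n) f = sumTo n f + f (suc n)

_·_ : Series → Series → Series
(f · g) n = sumTo n (λ k → f k * g (n ℕ.∸ k))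

-- Product of exponential generating functions (binomial convolution of the
-- sequences of derivatives at 0)
_⋆_ : Series → Series → Series
(f ⋆ g) n = sumTo n (λ k → + (n C k) * (f k * g (n ℕ.∸ k)))

_⊕_ : Series → Series → Series
(f ⊕ g) n = f n + g n

_⊖_ : Series → Series → Series
(f ⊖ g) n = f n - g n

mono : ℤ → ℕ → Series
mono c d n = if n ≡ᵇ d then c else + 0

-- Multiplicative inverse of a power series with constant term 1:
-- h 0 = 1,  h (m+1) = - Σ_{j=0}^{m} g (j+1) * h (m - j).
-- invP g m is correct on all indices ≤ m.
invP : Series → ℕ → Series
invP g zero    i = + 1
invP g (suc m) i =
  if does (i ≤? m) then invP g m i
  else - sumTo m (λ j → g (suc j) * invP g m (m ℕ.∸ j))

inv1 : Series → Series
inv1 g m = invP g m m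

den : (ℕ → ℤ) → (ℕ → ℤ) → ℕ → ℕ → Series
den a b zero    n = mono (+ 1) 0 ⊕ mono (b n) 3
den a b (suc k) n =
  (mono (+ 1) 0 ⊕ mono (b n) 3) ⊖ (mono (a (suc n)) 6 · inv1 (den a b k (suc n)))

convergent : Series → (ℕ → ℤ) → (ℕ → ℤ) → ℕ → Series
convergent N a b k = N · inv1 (den a b k 0)

JFracIs : Series → (ℕ → ℤ) → (ℕ → ℤ) → Series → Set
JFracIs N a b F = ∀ m → ∃ λ K → ∀ k → K ≤ k → convergent N a b k m ≡ F m

-- Formal Laplace transform: for f(u) = Σ f_ν u^ν/ν!, ∫₀^∞ f(u) e^{-u/x} du := Σ f_ν x^{ν+1}
-- (here f is given by its sequence f_ν = ν! a_ν of derivatives at 0).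
laplace : Series → Series
laplace f zero    = + 0
laplace f (suc n) = f n

-- sm, cm given by their derivative sequences at 0:
-- sm' = cm², cm' = -sm², sm(0) = 0, cm(0) = 1.
IsSmCm : Series → Series → Set
IsSmCm s c = (s 0 ≡ + 0) × (c 0 ≡ + 1)
           × (∀ n → s (suc n) ≡ (c ⋆ c) n)
           × (∀ n → c (suc n) ≡ - ((s ⋆ s) n))

t : ℕ → ℤ → ℤ
t n k = + (3 ℕ.* n) + k

a₁ b₁ a₂ b₂ a₃ b₃ a₄ b₄ a₅ b₅ a₆ b₆ : ℕ → ℤ
a₁ n = t n (- + 2) * (t n (- + 1) * t n (- + 1)) * (t n (+ 0) * t n (+ 0)) * t n (+ 1)
b₁ n = + 2 * t n (+ 1) * (t n (+ 1) * t n (+ 1) + + 1)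
a₂ n = t n (- + 1) * (t n (+ 0) * t n (+ 0)) * (t n (+ 1) * t n (+ 1)) * t n (+ 2)
b₂ n = + 2 * t n (+ 2) * (t n (+ 2) * t n (+ 2) + + 1)
a₃ n = t n (+ 0) * (t n (+ 1) * t n (+ 1)) * (t n (+ 2) * t n (+ 2)) * t n (+ 3)
b₃ n = + 2 * t n (+ 3) * (t n (+ 3) * t n (+ 3) + + 1)
a₄ n = (t n (- + 2) * t n (- + 2)) * (t n (- + 1) * t n (- + 1)) * (t n (+ 0) * t n (+ 0))
b₄ n = t n (- + 1) * (t n (+ 0) * t n (+ 0)) + (t n (+ 1) * t n (+ 1)) * t n (+ 2)
a₅ n = (t n (- + 1) * t n (- + 1)) * (t n (+ 0) * t n (+ 0)) * (t n (+ 1) * t n (+ 1))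
b₅ n = t n (+ 0) * (t n (+ 1) * t n (+ 1)) + (t n (+ 2) * t n (+ 2)) * t n (+ 3)
a₆ n = (t n (+ 0) * t n (+ 0)) * (t n (+ 1) * t n (+ 1)) * (t n (+ 2) * t n (+ 2))
b₆ n = t n (+ 1) * (t n (+ 2) * t n (+ 2)) + (t n (+ 3) * t n (+ 3)) * t n (+ 4)

{-# OPTIONS --safe #-}
module Submission where

-- Since s³ + c³ = 1, the third derivative of sⁿ is a combination of sⁿ⁻³, sⁿ
-- and sⁿ⁺³, and likewise for sⁿc. For the Laplace transforms Fⱼ of s³ʲ⁺ʳ
-- (or s³ʲ⁺ʳc) this is the three-term recurrence
--   (1 + bⱼx³) Fⱼ = pⱼx³ Fⱼ₋₁ + qⱼx³ Fⱼ₊₁,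
-- and iterating it as an expression for Fⱼ / Fⱼ₋₁ gives the continued fraction
-- with aⱼ = qⱼ₋₁pⱼ. To avoid dividing series, put Gⱼ = q₀⋯qⱼ₋₁ x³ʲ Fⱼ, so that
--   (1 + bⱼx³) Gⱼ = aⱼx⁶ Gⱼ₋₁ + Gⱼ₊₁;
-- the k-th convergent then differs from G₀ by a multiple of Gₖ₊₁, which is
-- divisible by x³ᵏ⁺³.

open import Defs
open import Algebra.Bundles using (CommutativeRing)
import Algebra.Construct.Pointwise as Pointwise
import Algebra.Properties.Group as GroupProperties
import Algebra.Properties.Ring as RingProperties
import Algebra.Solver.Ring.NaturalCoefficients.Default as SemiringSolver
open import Data.Bool using (if_then_else_)
open import Data.Integer using (ℤ; +_; _+_; _-_; _*_; -_)
import Data.Integer.Properties as ℤₚ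
open import Data.Integer.Tactic.RingSolver using (solve-∀)
open import Data.Nat using (ℕ; zero; suc; pred; _≤_; _<_; _≤?_; z≤n; s≤s; _∸_)
import Data.Nat as ℕ
open import Data.Nat.Combinatorics using (_C_; k>n⇒nCk≡0; nCk+nC[k+1]≡[n+1]C[k+1])
import Data.Nat.Properties as ℕₚ
open import Data.Product using (_,_; ∃; _×_)
open import Function using (_∘_)
open import Level using (0ℓ)
open import Relation.Binary.PropositionalEquality hiding (setoid)
import Relation.Binary.Reasoning.Setoid as SetoidReasoning
open import Relation.Nullary.Decidable using (yes; no; dec-true; dec-false)
open ≡-Reasoning

-- Differentiation runs through a cycle: `sⁿ` gives `sⁿ⁻¹c²`, `sⁿc²` gives `sⁿ⁻¹c` and `sⁿ⁺²c`, and
-- `sⁿc` gives `sⁿ⁻¹` and `sⁿ⁺²`, with `1 - s³` put for `c³`. Since the first of these has a single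
-- term, three steps shift the exponent of `s` by -3, 0 or 3 and never by 6, so no fourth term
-- appears. The two routes that return to the same exponent add up to `bⱼ`; the routes that only
-- descend or climb as far as possible give `pⱼ` and `qⱼ`. A ladder of exponents `r, r + 3, ...` has
-- a bottom because `n(n-1)(n-2)` vanishes at 0, 1 and 2; below `s³` lies the constant 1, whose
-- transform is known. The six fractions start at `r = 1, 2, 3` for `sⁿ` and at `r = 0, 1, 2` for
-- `sⁿc`.

module Pow = CommutativeRing (Pointwise.commutativeRing ℕ ℤₚ.+-*-commutativeRing)
open Pow using (_≈_)

one : Series
one = mono (+ 1) 0

-- One shift with two readings: `(f - f 0) / x` for ordinary series, the derivative for exponential
-- ones.
∂ : Series → Series
∂ f = f ∘ suc

infix 5 _+≡_ _≡+_

_+≡_ : ∀ x {y z} → y ≡ z → x + y ≡ x + z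
x +≡ e = cong (λ y → x + y) e

_≡+_ : ∀ {x y} → x ≡ y → ∀ z → x + z ≡ y + z
e ≡+ z = cong (λ x → x + z) e

interchange : ∀ a b c d → (a + b) + (c + d) ≡ (a + c) + (b + d)
interchange = solve-∀

-- Finite sums and the ring structure shared by both products

-- The bound `k ≤ n` is what allows `suc n ∸ k` to be replaced by `suc (n ∸ k)` under a sum.
sumTo-cong-≤ : ∀ n {f g} → (∀ k → k ≤ n → f k ≡ g k) → sumTo n f ≡ sumTo n g
sumTo-cong-≤ zero    e = e 0 z≤n
sumTo-cong-≤ (suc n) e =
  cong₂ _+_ (sumTo-cong-≤ n (λ k k≤n → e k (ℕₚ.m≤n⇒m≤1+n k≤n))) (e (suc n) ℕₚ.≤-refl)

sumTo-cong : ∀ n {f g} → f ≈ g → sumTo n f ≡ sumTo n g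
sumTo-cong n e = sumTo-cong-≤ n (λ k _ → e k)

sumTo-⊕ : ∀ n f g → sumTo n (f ⊕ g) ≡ sumTo n f + sumTo n g
sumTo-⊕ zero    f g = refl
sumTo-⊕ (suc n) f g = trans (sumTo-⊕ n f g ≡+ (f (suc n) + g (suc n))) (interchange (sumTo n f) (sumTo n g) _ _)

sumTo-0 : ∀ n {f} → (∀ k → f k ≡ + 0) → sumTo n f ≡ + 0
sumTo-0 zero    e = e 0
sumTo-0 (suc n) e = cong₂ _+_ (sumTo-0 n e) (e (suc n))

sumTo-first : ∀ n f → sumTo (suc n) f ≡ f 0 + sumTo n (∂ f)
sumTo-first zero    f = refl
sumTo-first (suc n) f =
  trans (sumTo-first n f ≡+ f (suc (suc n))) (ℤₚ.+-assoc (f 0) _ _)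

-- The ordinary and the exponential product have the same addition and the same unit, so only the
-- product laws vary. The resulting rings make the semiring solver available for series.
seriesRing : (_∙_ : Series → Series → Series) →
  (∀ {f f′ g g′} → f ≈ f′ → g ≈ g′ → (f ∙ g) ≈ (f′ ∙ g′)) →
  (∀ f g h → ((f ∙ g) ∙ h) ≈ (f ∙ (g ∙ h))) →
  (∀ f g → (f ∙ g) ≈ (g ∙ f)) →
  (∀ g → (one ∙ g) ≈ g) →
  (∀ f g h → (f ∙ (g ⊕ h)) ≈ ((f ∙ g) ⊕ (f ∙ h))) →
  CommutativeRing 0ℓ 0ℓ
seriesRing _∙_ ∙-cong ∙-assoc ∙-comm ∙-identityˡ ∙-distribˡ = record
  { 1# = one
  ; isCommutativeRing = record
    { isRing = record
      { +-isAbelianGroup = Pow.+-isAbelianGroup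
      ; *-cong = ∙-cong
      ; *-assoc = ∙-assoc
      ; *-identity = ∙-identityˡ , λ g n → trans (∙-comm g one n) (∙-identityˡ g n)
      ; distrib = ∙-distribˡ , λ f g h n → trans (∙-comm (g ⊕ h) f n)
          (trans (∙-distribˡ f g h n) (cong₂ _+_ (∙-comm f g n) (∙-comm f h n)))
      }
    ; *-comm = ∙-comm
    }
  }

-- Ordinary generating functions

·-cong : ∀ {f f′ g g′} → f ≈ f′ → g ≈ g′ → (f · g) ≈ (f′ · g′)
·-cong e e′ n = sumTo-cong n (λ k → cong₂ _*_ (e k) (e′ (n ∸ k)))

·-distribˡ : ∀ f g h → (f · (g ⊕ h)) ≈ ((f · g) ⊕ (f · h))
·-distribˡ f g h n =
  trans (sumTo-cong n (λ k → ℤₚ.*-distribˡ-+ (f k) (g (n ∸ k)) (h (n ∸ k)))) (sumTo-⊕ n _ _)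

·-suc : ∀ f g n → (f · g) (suc n) ≡ f 0 * g (suc n) + (∂ f · g) n
·-suc f g n = sumTo-first n _

·-sucʳ : ∀ f g n → (f · g) (suc n) ≡ (f · ∂ g) n + f (suc n) * g 0
·-sucʳ f g n = cong₂ _+_
  (sumTo-cong-≤ n (λ k k≤n → cong (λ i → f k * g i) (ℕₚ.+-∸-assoc 1 k≤n)))
  (cong (λ i → f (suc n) * g i) (ℕₚ.n∸n≡0 n))

-- Peeling the sum for `f · g` at its first term and that for `g · f` at its last avoids reversing a
-- sum.
·-comm : ∀ f g → (f · g) ≈ (g · f)
·-comm f g zero    = ℤₚ.*-comm (f 0) (g 0)
·-comm f g (suc n) = begin
  (f · g) (suc n)                   ≡⟨ ·-suc f g n ⟩
  f 0 * g (suc n) + (∂ f · g) n     ≡⟨ ℤₚ.+-comm _ ((∂ f · g) n) ⟩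
  (∂ f · g) n + f 0 * g (suc n)     ≡⟨ cong₂ _+_ (·-comm (∂ f) g n) (ℤₚ.*-comm (f 0) _) ⟩
  (g · ∂ f) n + g (suc n) * f 0     ≡⟨ ·-sucʳ g f n ⟨
  (g · f) (suc n)                   ∎

-- Since `∂ (f · g)` is `f 0` times `∂ g` plus `∂ f · g`, peeling `f` leaves the triple `∂ f`, `g`,
-- `h` at a smaller index.
·-assoc : ∀ f g h → ((f · g) · h) ≈ (f · (g · h))
·-assoc f g h zero    = ℤₚ.*-assoc (f 0) _ _
·-assoc f g h (suc n) = begin
  ((f · g) · h) (suc n)
    ≡⟨ ·-suc (f · g) h n ⟩
  f 0 * g 0 * h (suc n) + (∂ (f · g) · h) n
    ≡⟨ cong (λ x → f 0 * g 0 * h (suc n) + x) ∂[f·g]·h ⟩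
  f 0 * g 0 * h (suc n) + (f 0 * (∂ g · h) n + (∂ f · (g · h)) n)
    ≡⟨ factor (f 0) _ _ _ _ ⟩
  f 0 * (g 0 * h (suc n) + (∂ g · h) n) + (∂ f · (g · h)) n
    ≡⟨ cong (λ x → f 0 * x + (∂ f · (g · h)) n) (·-suc g h n) ⟨
  f 0 * (g · h) (suc n) + (∂ f · (g · h)) n
    ≡⟨ ·-suc f (g · h) n ⟨
  (f · (g · h)) (suc n) ∎
  where
  factor : ∀ a b c d e → a * b * c + (a * d + e) ≡ a * (b * c + d) + e
  factor = solve-∀
  scale : Series
  scale k = f 0 * g (suc k)
  sumTo-* : ∀ m x u → sumTo m (λ k → x * u k) ≡ x * sumTo m u
  sumTo-* zero    x u = refl
  sumTo-* (suc m) x u = trans (sumTo-* m x u ≡+ (x * u (suc m))) (sym (ℤₚ.*-distribˡ-+ x (sumTo m u) _))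
  ∂[f·g]·h : (∂ (f · g) · h) n ≡ f 0 * (∂ g · h) n + (∂ f · (g · h)) n
  ∂[f·g]·h = begin
    (∂ (f · g) · h) n
      ≡⟨ ·-cong {g = h} (·-suc f g) (λ _ → refl) n ⟩
    ((scale ⊕ (∂ f · g)) · h) n
      ≡⟨ ·-comm (scale ⊕ (∂ f · g)) h n ⟩
    (h · (scale ⊕ (∂ f · g))) n
      ≡⟨ ·-distribˡ h scale (∂ f · g) n ⟩
    (h · scale) n + (h · (∂ f · g)) n
      ≡⟨ cong₂ _+_ (·-comm h scale n) (·-comm h (∂ f · g) n) ⟩
    (scale · h) n + ((∂ f · g) · h) n
      ≡⟨ cong₂ _+_ (trans (sumTo-cong n (λ k → ℤₚ.*-assoc (f 0) (g (suc k)) (h (n ∸ k)))) (sumTo-* n (f 0) _))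
                   (·-assoc (∂ f) g h n) ⟩
    f 0 * (∂ g · h) n + (∂ f · (g · h)) n ∎

mono-zero-· : ∀ x g → (mono x 0 · g) ≈ (λ n → x * g n)
mono-zero-· x g zero    = refl
mono-zero-· x g (suc n) = begin
  (mono x 0 · g) (suc n)                 ≡⟨ ·-suc (mono x 0) g n ⟩
  x * g (suc n) + (∂ (mono x 0) · g) n   ≡⟨ (x * g (suc n)) +≡ sumTo-0 n (λ k → refl) ⟩
  x * g (suc n) + + 0                    ≡⟨ ℤₚ.+-identityʳ _ ⟩
  x * g (suc n)                          ∎

ordinary : CommutativeRing 0ℓ 0ℓ
ordinary = seriesRing _·_ ·-cong ·-assoc ·-comm
  (λ g n → trans (mono-zero-· (+ 1) g n) (ℤₚ.*-identityˡ (g n))) ·-distribˡ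

-- Exponential generating functions

⋆-cong : ∀ {f f′ g g′} → f ≈ f′ → g ≈ g′ → (f ⋆ g) ≈ (f′ ⋆ g′)
⋆-cong e e′ n = sumTo-cong n (λ k → cong (+ (n C k) *_) (cong₂ _*_ (e k) (e′ (n ∸ k))))

⋆-distribˡ : ∀ f g h → (f ⋆ (g ⊕ h)) ≈ ((f ⋆ g) ⊕ (f ⋆ h))
⋆-distribˡ f g h n =
  trans (sumTo-cong n (λ k → expand (+ (n C k)) (f k) (g (n ∸ k)) (h (n ∸ k)))) (sumTo-⊕ n _ _)
  where
  expand : ∀ a b c d → a * (b * (c + d)) ≡ a * (b * c) + a * (b * d)
  expand = solve-∀

⋆-distribʳ : ∀ f g h → ((g ⊕ h) ⋆ f) ≈ ((g ⋆ f) ⊕ (h ⋆ f))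
⋆-distribʳ f g h n =
  trans (sumTo-cong n (λ k → expand (+ (n C k)) (f (n ∸ k)) (g k) (h k))) (sumTo-⊕ n _ _)
  where
  expand : ∀ a b c d → a * ((c + d) * b) ≡ a * (c * b) + a * (d * b)
  expand = solve-∀

-- Pascal's rule splits each binomial in two. With the product rule, commutativity and associativity
-- of `⋆` become inductions on the index without further binomial identities.
leibniz : ∀ f g → ∂ (f ⋆ g) ≈ ((∂ f ⋆ g) ⊕ (f ⋆ ∂ g))
leibniz f g n = begin
  (f ⋆ g) (suc n)
    ≡⟨ sumTo-first n _ ⟩
  + 1 * f0g + sumTo n (λ k → + (suc n C suc k) * h k)
    ≡⟨ (+ 1 * f0g) +≡ sumTo-cong n pascal ⟩
  + 1 * f0g + sumTo n ((λ k → + (n C k) * h k) ⊕ (λ k → + (n C suc k) * h k))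
    ≡⟨ (+ 1 * f0g) +≡ sumTo-⊕ n _ _ ⟩
  + 1 * f0g + ((∂ f ⋆ g) n + sumTo n (λ k → + (n C suc k) * h k))
    ≡⟨ swap (+ 1 * f0g) ((∂ f ⋆ g) n) _ ⟩
  (∂ f ⋆ g) n + (+ 1 * f0g + sumTo n (λ k → + (n C suc k) * h k))
    ≡⟨ (∂ f ⋆ g) n +≡ sumTo-first n (λ k → + (n C k) * (f k * g (suc n ∸ k))) ⟨
  -- The sum is extended to index `suc n`, where the binomial `n C suc n` is zero.
  (∂ f ⋆ g) n + (sumTo n (λ k → + (n C k) * (f k * g (suc n ∸ k))) + + (n C suc n) * h n)
    ≡⟨ (∂ f ⋆ g) n +≡ cong₂ _+_ shifted vanishing ⟩
  (∂ f ⋆ g) n + ((f ⋆ ∂ g) n + + 0)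
    ≡⟨ (∂ f ⋆ g) n +≡ ℤₚ.+-identityʳ ((f ⋆ ∂ g) n) ⟩
  (∂ f ⋆ g) n + (f ⋆ ∂ g) n ∎
  where
  f0g : ℤ
  f0g = f 0 * g (suc n)
  h : Series
  h k = f (suc k) * g (n ∸ k)
  swap : ∀ a b c → a + (b + c) ≡ b + (a + c)
  swap = solve-∀
  pascal : ∀ k → + (suc n C suc k) * h k ≡ + (n C k) * h k + + (n C suc k) * h k
  pascal k = trans (cong (λ x → + x * h k) (sym (nCk+nC[k+1]≡[n+1]C[k+1] n k)))
                   (ℤₚ.*-distribʳ-+ (h k) (+ (n C k)) (+ (n C suc k)))
  shifted : sumTo n (λ k → + (n C k) * (f k * g (suc n ∸ k))) ≡ (f ⋆ ∂ g) n
  shifted = sumTo-cong-≤ n (λ k k≤n →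
    cong (λ i → + (n C k) * (f k * g i)) (ℕₚ.+-∸-assoc 1 k≤n))
  vanishing : + (n C suc n) * h n ≡ + 0
  vanishing = trans (cong (λ x → + x * h n) (k>n⇒nCk≡0 (ℕₚ.n<1+n n))) (ℤₚ.*-zeroˡ (h n))

⋆-comm : ∀ f g → (f ⋆ g) ≈ (g ⋆ f)
⋆-comm f g zero    = cong (+ 1 *_) (ℤₚ.*-comm (f 0) (g 0))
⋆-comm f g (suc n) = begin
  (f ⋆ g) (suc n)            ≡⟨ leibniz f g n ⟩
  (∂ f ⋆ g) n + (f ⋆ ∂ g) n  ≡⟨ cong₂ _+_ (⋆-comm (∂ f) g n) (⋆-comm f (∂ g) n) ⟩
  (g ⋆ ∂ f) n + (∂ g ⋆ f) n  ≡⟨ ℤₚ.+-comm ((g ⋆ ∂ f) n) _ ⟩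
  (∂ g ⋆ f) n + (g ⋆ ∂ f) n  ≡⟨ leibniz g f n ⟨
  (g ⋆ f) (suc n)            ∎

⋆-assoc : ∀ f g h → ((f ⋆ g) ⋆ h) ≈ (f ⋆ (g ⋆ h))
⋆-assoc f g h zero    = base (f 0) (g 0) (h 0)
  where
  base : ∀ a b c → + 1 * (+ 1 * (a * b) * c) ≡ + 1 * (a * (+ 1 * (b * c)))
  base = solve-∀
⋆-assoc f g h (suc n) = begin
  ((f ⋆ g) ⋆ h) (suc n)
    ≡⟨ leibniz (f ⋆ g) h n ⟩
  (∂ (f ⋆ g) ⋆ h) n + ((f ⋆ g) ⋆ ∂ h) n
    ≡⟨ trans (⋆-cong {g = h} (leibniz f g) (λ _ → refl) n) (⋆-distribʳ h (∂ f ⋆ g) (f ⋆ ∂ g) n)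
       ≡+ ((f ⋆ g) ⋆ ∂ h) n ⟩
  ((∂ f ⋆ g) ⋆ h) n + ((f ⋆ ∂ g) ⋆ h) n + ((f ⋆ g) ⋆ ∂ h) n
    ≡⟨ cong₂ _+_ (cong₂ _+_ (⋆-assoc (∂ f) g h n) (⋆-assoc f (∂ g) h n)) (⋆-assoc f g (∂ h) n) ⟩
  (∂ f ⋆ (g ⋆ h)) n + (f ⋆ (∂ g ⋆ h)) n + (f ⋆ (g ⋆ ∂ h)) n
    ≡⟨ ℤₚ.+-assoc ((∂ f ⋆ (g ⋆ h)) n) _ _ ⟩
  (∂ f ⋆ (g ⋆ h)) n + ((f ⋆ (∂ g ⋆ h)) n + (f ⋆ (g ⋆ ∂ h)) n)
    ≡⟨ (∂ f ⋆ (g ⋆ h)) n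
       +≡ trans (⋆-cong {f} (λ _ → refl) (leibniz g h) n) (⋆-distribˡ f (∂ g ⋆ h) (g ⋆ ∂ h) n) ⟨
  (∂ f ⋆ (g ⋆ h)) n + (f ⋆ ∂ (g ⋆ h)) n
    ≡⟨ leibniz f (g ⋆ h) n ⟨
  (f ⋆ (g ⋆ h)) (suc n) ∎

mono-zero-⋆ : ∀ x g → (mono x 0 ⋆ g) ≈ (λ n → x * g n)
mono-zero-⋆ x g zero    = ℤₚ.*-identityˡ (x * g 0)
mono-zero-⋆ x g (suc n) = begin
  (mono x 0 ⋆ g) (suc n)
    ≡⟨ leibniz (mono x 0) g n ⟩
  (∂ (mono x 0) ⋆ g) n + (mono x 0 ⋆ ∂ g) n
    ≡⟨ cong₂ _+_ (sumTo-0 n (λ k → ℤₚ.*-zeroʳ (+ (n C k)))) (mono-zero-⋆ x (∂ g) n) ⟩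
  + 0 + x * g (suc n)
    ≡⟨ ℤₚ.+-identityˡ _ ⟩
  x * g (suc n) ∎

exponential : CommutativeRing 0ℓ 0ℓ
exponential = seriesRing _⋆_ ⋆-cong ⋆-assoc ⋆-comm
  (λ g n → trans (mono-zero-⋆ (+ 1) g n) (ℤₚ.*-identityˡ (g n))) ⋆-distribˡ

-- Convergents of the continued fraction

-- Passing from stage `m` to `suc m` alters only indices above `m`, so an entry once correct is
-- never touched again.
invP-stable : ∀ g m i → i ≤ m → invP g m i ≡ inv1 g i
invP-stable g zero    zero z≤n = refl
invP-stable g (suc m) i i≤1+m with i ≤? m
... | yes i≤m = trans
  (cong (λ b → if b then invP g m i else _) (dec-true (i ≤? m) i≤m)) (invP-stable g m i i≤m)
... | no  i≰m rewrite ℕₚ.≤-antisym i≤1+m (ℕₚ.≰⇒> i≰m) = refl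

inv1-suc : ∀ g m → inv1 g (suc m) ≡ - (∂ g · inv1 g) m
inv1-suc g m = trans
  (cong (λ b → if b then invP g m (suc m) else - sumTo m (λ j → g (suc j) * invP g m (m ∸ j)))
        (dec-false (suc m ≤? m) ℕₚ.1+n≰n))
  (cong -_ (sumTo-cong m (λ j → cong (g (suc j) *_) (invP-stable g m (m ∸ j) (ℕₚ.m∸n≤m m j)))))

inv1-inverseʳ : ∀ g → g 0 ≡ + 1 → (g · inv1 g) ≈ one
inv1-inverseʳ g g0 zero    = cong (_* + 1) g0
inv1-inverseʳ g g0 (suc m) = begin
  (g · inv1 g) (suc m)
    ≡⟨ ·-suc g (inv1 g) m ⟩
  g 0 * inv1 g (suc m) + (∂ g · inv1 g) m
    ≡⟨ cong₂ _*_ g0 (inv1-suc g m) ≡+ (∂ g · inv1 g) m ⟩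
  + 1 * - (∂ g · inv1 g) m + (∂ g · inv1 g) m
    ≡⟨ cancel ((∂ g · inv1 g) m) ⟩
  + 0 ∎
  where
  cancel : ∀ x → + 1 * - x + x ≡ + 0
  cancel = solve-∀

den-0 : ∀ a b k j → den a b k j 0 ≡ + 1
den-0 a b zero    j = refl
den-0 a b (suc k) j = refl

module O  = CommutativeRing ordinary
module OR = SetoidReasoning O.setoid
module OS = SemiringSolver O.commutativeSemiring

open GroupProperties O.+-group using () renaming (∙-cancelʳ to +-cancelʳ)

Vanishes : ℕ → Series → Set
Vanishes m f = ∀ i → i < m → f i ≡ + 0

vanishes-·ʳ : ∀ {m} f {g} → Vanishes m g → Vanishes m (f · g)
vanishes-·ʳ f {g} v n n<m = sumTo-0 n λ k →
  trans (cong (f k *_) (v (n ∸ k) (ℕₚ.≤-<-trans (ℕₚ.m∸n≤m n k) n<m))) (ℤₚ.*-zeroʳ (f k))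

vanishes-·ˡ : ∀ {m f} g → Vanishes m f → Vanishes m (f · g)
vanishes-·ˡ {f = f} g v n n<m = trans (·-comm f g n) (vanishes-·ʳ g v n n<m)

vanishes-mono : ∀ x d → Vanishes d (mono x d)
vanishes-mono x (suc d) zero    _         = refl
vanishes-mono x (suc d) (suc i) (s≤s i<d) = vanishes-mono x d i i<d

-- `H 0` is the numerator and `H (suc j)` the term with `G j`, so that one recurrence covers the
-- head of the fraction and its tails.
module _ (a b : ℕ → ℤ) (G H : ℕ → Series)
  (rec : ∀ j → ((one ⊕ mono (b j) 3) · G j) ≈ (H j ⊕ G (suc j)))
  (H-suc : ∀ j → H (suc j) ≈ (mono (a (suc j)) 6 · G j))
  (small : ∀ j → Vanishes j (G j)) where

  open OS using (solve; _:+_; _:*_; _:=_)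

  -- Denominators have constant term 1 and can be inverted. Here `f` is the main term and `E` the
  -- truncation error.
  den-solve : ∀ k j f E → (den a b k j · G j) ≈ (f ⊕ E) →
    G j ≈ ((f · inv1 (den a b k j)) ⊕ (inv1 (den a b k j) · E))
  den-solve k j f E e = OR.begin
    G j                     OR.≈⟨ O.*-identityˡ (G j) ⟨
    one · G j               OR.≈⟨ O.*-cong {one} {d · I} {G j} (λ n → sym (inv1-inverseʳ d (den-0 a b k j) n)) O.refl ⟩
    (d · I) · G j           OR.≈⟨ solve 3 (λ d i g → (d :* i) :* g := i :* (d :* g)) O.refl d I (G j) ⟩
    I · (d · G j)           OR.≈⟨ O.*-congˡ {I} e ⟩
    I · (f ⊕ E)             OR.≈⟨ solve 3 (λ i f e → i :* (f :+ e) := f :* i :+ i :* e) O.refl I f E ⟩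
    (f · I) ⊕ (I · E)       OR.∎
    where
    d I : Series
    d = den a b k j
    I = inv1 d

  -- Solving the depth-`k` relation for `G (suc j)` and inserting it into `rec j` produces exactly
  -- the tail subtracted in `den a b (suc k) j`. Unfolded, `E` is `G (suc (k + j))` times the
  -- inverses of the inner denominators.
  den-residue : ∀ k j → ∃ λ E → Vanishes (suc (k ℕ.+ j)) E × (den a b k j · G j) ≈ (H j ⊕ E)
  den-residue zero    j = G (suc j) , small (suc j) , rec j
  den-residue (suc k) j with den-residue k (suc j)
  ... | E , v , e = I · E , v′ , step
    where
    d′ I A U : Series
    d′ = den a b k (suc j)
    I = inv1 d′
    A = mono (a (suc j)) 6
    U = one ⊕ mono (b j) 3
    v′ : Vanishes (suc (suc k ℕ.+ j)) (I · E)
    v′ = subst (λ m → Vanishes (suc m) (I · E)) (ℕₚ.+-suc k j) (vanishes-·ʳ I v)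
    G-suc : G (suc j) ≈ (((A · G j) · I) ⊕ (I · E))
    G-suc = den-solve k (suc j) (A · G j) E (O.trans e (O.+-congʳ {E} (H-suc j)))
    add-sub : ∀ x y → x ≡ x + - y + y
    add-sub = solve-∀
    -- Adding `(A · I) · G j` to both sides removes the subtraction in `den`, which leaves semiring
    -- identities.
    sum : (((U ⊖ (A · I)) · G j) ⊕ ((A · I) · G j)) ≈ ((H j ⊕ (I · E)) ⊕ ((A · I) · G j))
    sum = OR.begin
      ((U ⊖ (A · I)) · G j) ⊕ ((A · I) · G j)
        OR.≈⟨ O.distribʳ (G j) (U ⊖ (A · I)) (A · I) ⟨
      ((U ⊖ (A · I)) ⊕ (A · I)) · G j
        OR.≈⟨ O.*-congʳ {G j} (λ n → add-sub (U n) ((A · I) n)) ⟨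
      U · G j
        OR.≈⟨ rec j ⟩
      H j ⊕ G (suc j)
        OR.≈⟨ O.+-congˡ {H j} G-suc ⟩
      H j ⊕ (((A · G j) · I) ⊕ (I · E))
        OR.≈⟨ solve 5 (λ h a g i e → h :+ ((a :* g) :* i :+ i :* e) := (h :+ i :* e) :+ (a :* i) :* g)
               O.refl (H j) A (G j) I E ⟩
      (H j ⊕ (I · E)) ⊕ ((A · I) · G j) OR.∎
    step : (den a b (suc k) j · G j) ≈ (H j ⊕ (I · E))
    step = +-cancelʳ ((A · I) · G j) _ _ sum

  convergents : JFracIs (H 0) a b (G 0)
  -- The error of the `k`-th convergent vanishes at every index up to `k`, so `K = m` will do.
  convergents m = m , λ k m≤k → let E , v , e = den-residue k 0 ; I = inv1 (den a b k 0) in begin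
    (H 0 · I) m
      ≡⟨ ℤₚ.+-identityʳ _ ⟨
    (H 0 · I) m + + 0
      ≡⟨ (H 0 · I) m +≡ vanishes-·ʳ I v m (s≤s (ℕₚ.≤-trans m≤k (ℕₚ.m≤m+n k 0))) ⟨
    (H 0 · I) m + (I · E) m
      ≡⟨ den-solve k 0 (H 0) E e m ⟨
    G 0 m ∎

mono-suc-· : ∀ x d f n → (mono x (suc d) · f) (suc n) ≡ (mono x d · f) n
mono-suc-· x d f n = trans (·-suc (mono x (suc d)) f n) (ℤₚ.+-identityˡ _)

*-mono : ∀ x y d n → x * mono y d n ≡ mono (x * y) d n
*-mono x y zero    zero    = refl
*-mono x y zero    (suc n) = ℤₚ.*-zeroʳ x
*-mono x y (suc d) zero    = ℤₚ.*-zeroʳ x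
*-mono x y (suc d) (suc n) = *-mono x y d n

mono-·-mono : ∀ x d y e → (mono x d · mono y e) ≈ mono (x * y) (d ℕ.+ e)
mono-·-mono x zero    y e n       = trans (mono-zero-· x (mono y e) n) (*-mono x y e n)
mono-·-mono x (suc d) y e zero    = refl
mono-·-mono x (suc d) y e (suc n) =
  trans (mono-suc-· x d (mono y e) n) (mono-·-mono x d y e n)

-- From a three-term recurrence to its continued fraction

module _ (p q b a : ℕ → ℤ) (N : Series) (F : ℕ → Series)
  (rec₀ : ((one ⊕ mono (b 0) 3) · F 0) ≈ (N ⊕ (mono (q 0) 3 · F 1)))
  (rec₊ : ∀ j → ((one ⊕ mono (b (suc j)) 3) · F (suc j)) ≈
                ((mono (p (suc j)) 3 · F j) ⊕ (mono (q (suc j)) 3 · F (suc (suc j)))))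
  (a-suc : ∀ j → a (suc j) ≡ q j * p (suc j)) where

  private
    open OS using (solve; _:+_; _:*_; _:=_)

    Q : ℕ → ℤ
    Q zero    = + 1
    Q (suc j) = q j * Q j

    M G H : ℕ → Series
    M j = mono (Q j) (j ℕ.* 3)
    G j = M j · F j
    H zero    = N
    H (suc j) = mono (a (suc j)) 6 · G j

    G-0 : G 0 ≈ F 0
    G-0 n = trans (mono-zero-· (+ 1) (F 0) n) (ℤₚ.*-identityˡ (F 0 n))

    M-suc : ∀ j → (mono (q j) 3 · M j) ≈ M (suc j)
    M-suc j = mono-·-mono (q j) 3 (Q j) (j ℕ.* 3)

    -- The order `j * 3` of `M j` is weakened to `j`, which still grows without bound.
    small : ∀ j → Vanishes j (G j)
    small j i i<j = vanishes-·ˡ (F j) (vanishes-mono (Q j) (j ℕ.* 3)) i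
                      (ℕₚ.<-≤-trans i<j (ℕₚ.m≤m*n j 3))

    -- The origin of `a` and of `x⁶`: `M (suc j)` contains one factor `q j x³` more than `M j`, and
    -- it joins `p (suc j) x³`.
    down : ∀ j → (mono (p (suc j)) 3 · M (suc j)) ≈ (mono (a (suc j)) 6 · M j)
    down j = OR.begin
      mono (p (suc j)) 3 · M (suc j)
        OR.≈⟨ mono-·-mono (p (suc j)) 3 (Q (suc j)) (suc j ℕ.* 3) ⟩
      mono (p (suc j) * (q j * Q j)) (6 ℕ.+ j ℕ.* 3)
        OR.≈⟨ (λ n → cong (λ x → mono x (6 ℕ.+ j ℕ.* 3) n)
               (trans (reorder (p (suc j)) (q j) (Q j)) (cong (_* Q j) (sym (a-suc j))))) ⟩
      mono (a (suc j) * Q j) (6 ℕ.+ j ℕ.* 3)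
        OR.≈⟨ mono-·-mono (a (suc j)) 6 (Q j) (j ℕ.* 3) ⟨
      mono (a (suc j)) 6 · M j OR.∎
      where
      reorder : ∀ x y z → x * (y * z) ≡ y * x * z
      reorder = solve-∀

    rec : ∀ j → ((one ⊕ mono (b j) 3) · G j) ≈ (H j ⊕ G (suc j))
    rec zero = OR.begin
      U · (M 0 · F 0)                   OR.≈⟨ O.*-congˡ {U} G-0 ⟩
      U · F 0                           OR.≈⟨ rec₀ ⟩
      N ⊕ (mono (q 0) 3 · F 1)          OR.≈⟨ O.+-congˡ {N} (O.*-congʳ {F 1} (λ n → trans (sym (M1 n)) (M-suc 0 n))) ⟩
      N ⊕ G 1                           OR.∎
      where
      U : Series
      U = one ⊕ mono (b 0) 3
      M1 : (mono (q 0) 3 · one) ≈ mono (q 0) 3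
      M1 = O.*-identityʳ (mono (q 0) 3)
    rec (suc j) = OR.begin
      U · (M (suc j) · F (suc j))
        OR.≈⟨ solve 3 (λ u m f → u :* (m :* f) := m :* (u :* f)) O.refl U (M (suc j)) (F (suc j)) ⟩
      M (suc j) · (U · F (suc j))
        OR.≈⟨ O.*-congˡ {M (suc j)} (rec₊ j) ⟩
      M (suc j) · ((P · F j) ⊕ (Q′ · F (suc (suc j))))
        OR.≈⟨ solve 5 (λ m p f q f′ → m :* (p :* f :+ q :* f′) := (p :* m) :* f :+ (q :* m) :* f′)
               O.refl (M (suc j)) P (F j) Q′ (F (suc (suc j))) ⟩
      ((P · M (suc j)) · F j) ⊕ ((Q′ · M (suc j)) · F (suc (suc j)))
        OR.≈⟨ O.+-cong (O.*-congʳ {F j} (down j)) (O.*-congʳ {F (suc (suc j))} (M-suc (suc j))) ⟩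
      ((mono (a (suc j)) 6 · M j) · F j) ⊕ G (suc (suc j))
        OR.≈⟨ O.+-congʳ {G (suc (suc j))} (O.*-assoc (mono (a (suc j)) 6) (M j) (F j)) ⟩
      H (suc j) ⊕ G (suc (suc j)) OR.∎
      where
      U P Q′ : Series
      U  = one ⊕ mono (b (suc j)) 3
      P  = mono (p (suc j)) 3
      Q′ = mono (q (suc j)) 3

  jfrac : JFracIs N a b (F 0)
  jfrac m = let K , e = convergents a b G H rec (λ _ _ → refl) small m in
    K , λ k K≤k → trans (e k K≤k) (G-0 m)

-- Laplace transforms and third derivatives

-- The third derivative of `sⁿ` is `falling n sⁿ⁻³ - middleS n sⁿ + rising n
-- sⁿ⁺³`; that of `sⁿc` has `middleSC n` and `rising (n + 1)` instead. The middle terms sum two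
-- routes: `middleS n = n(n-1)² + n(n+1)²`, and the two summands of `middleSC n`.
falling rising middleS middleSC : ℤ → ℤ
falling z = z * (z - + 1) * (z - + 2)
rising  z = z * (z + + 1) * (z + + 2)
middleS  z = + 2 * z * (z * z + + 1)
middleSC z = (z - + 1) * (z * z) + ((z + + 1) * (z + + 1)) * (z + + 2)

cubic-· : ∀ x f → ((one ⊕ mono x 3) · f) ≈ (f ⊕ (mono x 3 · f))
cubic-· x f = O.trans (O.distribʳ f one (mono x 3)) (O.+-congʳ {mono x 3 · f} (O.*-identityˡ f))

mono-3-· : ∀ x f n → (mono x 3 · f) (3 ℕ.+ n) ≡ x * f n
mono-3-· x f n = begin
  (mono x 3 · f) (3 ℕ.+ n)   ≡⟨ mono-suc-· x 2 f (2 ℕ.+ n) ⟩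
  (mono x 2 · f) (2 ℕ.+ n)   ≡⟨ mono-suc-· x 1 f (1 ℕ.+ n) ⟩
  (mono x 1 · f) (1 ℕ.+ n)   ≡⟨ mono-suc-· x 0 f n ⟩
  (mono x 0 · f) n           ≡⟨ mono-zero-· x f n ⟩
  x * f n                    ∎

-- Under the transform, `x³` undoes three derivatives up to the values at 0, 1 and 2. The series `h`
-- carries these values along with the source term.
laplace-cubic : ∀ f g h x y → (∀ n → n < 3 → f n ≡ h n) →
  (∀ n → f (3 ℕ.+ n) + x * f n ≡ h (3 ℕ.+ n) + y * g n) →
  ((one ⊕ mono x 3) · laplace f) ≈ (laplace h ⊕ (mono y 3 · laplace g))
laplace-cubic f g h x y low rec n = trans (cubic-· x (laplace f) n) (go n)
  where
  go : (laplace f ⊕ (mono x 3 · laplace f)) ≈ (laplace h ⊕ (mono y 3 · laplace g))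
  go 0 = refl
  go 1 = cong (_+ + 0) (low 0 (s≤s z≤n))
  go 2 = cong (_+ + 0) (low 1 (s≤s (s≤s z≤n)))
  go (suc (suc (suc n))) = begin
    laplace f (3 ℕ.+ n) + (mono x 3 · laplace f) (3 ℕ.+ n)
      ≡⟨ laplace f (3 ℕ.+ n) +≡ mono-3-· x (laplace f) n ⟩
    laplace f (3 ℕ.+ n) + x * laplace f n
      ≡⟨ laplace-rec n ⟩
    laplace h (3 ℕ.+ n) + y * laplace g n
      ≡⟨ laplace h (3 ℕ.+ n) +≡ mono-3-· y (laplace g) n ⟨
    laplace h (3 ℕ.+ n) + (mono y 3 · laplace g) (3 ℕ.+ n) ∎
    where
    laplace-rec : ∀ n → laplace f (3 ℕ.+ n) + x * laplace f n ≡ laplace h (3 ℕ.+ n) + y * laplace g n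
    -- The coefficient of `x³` is still an initial value, `f 2`, because `laplace` shifts by one.
    laplace-rec zero    = cong₂ _+_ (low 2 (s≤s (s≤s (s≤s z≤n)))) (trans (ℤₚ.*-zeroʳ x) (sym (ℤₚ.*-zeroʳ y)))
    laplace-rec (suc n) = rec n

laplace-mono-3 : ∀ x f → laplace (mono x 3 · f) ≈ (mono x 3 · laplace f)
laplace-mono-3 x f 0 = refl
laplace-mono-3 x f 1 = refl
laplace-mono-3 x f 2 = refl
laplace-mono-3 x f 3 = sym (trans (mono-3-· x (laplace f) 0) (ℤₚ.*-zeroʳ x))
laplace-mono-3 x f (suc (suc (suc (suc n)))) =
  trans (mono-3-· x f n) (sym (mono-3-· x (laplace f) (suc n)))

laplace-mono : ∀ x d → laplace (mono x d) ≈ mono x (suc d)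
laplace-mono x d zero    = refl
laplace-mono x d (suc n) = refl

jfrac-cong : ∀ {N a b F F′} → F ≈ F′ → JFracIs N a b F → JFracIs N a b F′
jfrac-cong e jf m = let K , h = jf m in K , λ k K≤k → trans (h k K≤k) (e m)

laplace-cong : ∀ {f g} → f ≈ g → laplace f ≈ laplace g
laplace-cong e zero    = refl
laplace-cong e (suc n) = e n

-- `W n` is `sⁿ` or `sⁿc`. The truncation in `n ∸ 3` is harmless in both uses, as `P` is then
-- `falling`, which is zero for `n < 3`.
module Ladder (W : ℕ → Series) (P Q B : ℤ → ℤ)
  (third : ∀ n i → W n (3 ℕ.+ i) + B (+ n) * W n i ≡ P (+ n) * W (n ∸ 3) i + Q (+ n) * W (3 ℕ.+ n) i)
  (vanishes : ∀ n → Vanishes n (W n)) where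

  -- The numerator collects the initial values of W r and the term P r · W (r - 3).
  ladder : ∀ r x d a b f → W r ≈ f →
    (∀ i → i < 3 → W r i ≡ mono x d i) →
    (∀ i → P (+ r) * W (r ∸ 3) i ≡ mono x d (3 ℕ.+ i)) →
    (∀ j → b j ≡ B (+ (3 ℕ.* j) + + r)) →
    (∀ j → a j ≡ Q (+ (3 ℕ.* j) - + 3 + + r) * P (+ (3 ℕ.* j) + + r)) →
    JFracIs (mono x (suc d)) a b (laplace f)
  ladder r x d a b f W≈f low₀ init b≡ a≡ =
    jfrac-cong {mono x (suc d)} {a} {b} {laplace (W r)} {laplace f} (laplace-cong W≈f)
      (jfrac p q b a (mono x (suc d)) (λ j → laplace (W (index j))) rec₀ rec₊ a-suc)
    where
    index : ℕ → ℕ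
    index j = j ℕ.* 3 ℕ.+ r
    p q : ℕ → ℤ
    p j = P (+ index j)
    q j = Q (+ index j)
    index≡ : ∀ j → + (3 ℕ.* j) + + r ≡ + index j
    index≡ j = cong (λ k → + (k ℕ.+ r)) (ℕₚ.*-comm 3 j)
    third′ : ∀ j i → W (index j) (3 ℕ.+ i) + b j * W (index j) i
                   ≡ p j * W (index j ∸ 3) i + q j * W (index (suc j)) i
    third′ j i = trans
      (cong (λ y → W (index j) (3 ℕ.+ i) + y * W (index j) i) (trans (b≡ j) (cong B (index≡ j))))
      (third (index j) i)
    a-suc : ∀ j → a (suc j) ≡ q j * p (suc j)
    a-suc j = trans (a≡ (suc j)) (cong₂ (λ y z → Q y * P z) index-pred (index≡ (suc j)))
      where
      cancel : ∀ z y → + 3 + z - + 3 + y ≡ z + y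
      cancel = solve-∀
      index-pred : + (3 ℕ.* suc j) - + 3 + + r ≡ + index j
      index-pred = begin
        + (3 ℕ.* suc j) - + 3 + + r       ≡⟨ cong (λ k → + k - + 3 + + r) (ℕₚ.*-suc 3 j) ⟩
        + 3 + + (3 ℕ.* j) - + 3 + + r     ≡⟨ cancel (+ (3 ℕ.* j)) (+ r) ⟩
        + (3 ℕ.* j) + + r                 ≡⟨ index≡ j ⟩
        + index j                         ∎
    rec₀ : ((one ⊕ mono (b 0) 3) · laplace (W r)) ≈
           (mono x (suc d) ⊕ (mono (q 0) 3 · laplace (W (3 ℕ.+ r))))
    rec₀ = O.trans
      (laplace-cubic (W r) (W (3 ℕ.+ r)) (mono x d) (b 0) (q 0) low₀
        (λ i → trans (third′ 0 i) (init i ≡+ (q 0 * W (3 ℕ.+ r) i))))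
      (O.+-congʳ {mono (q 0) 3 · laplace (W (3 ℕ.+ r))} (laplace-mono x d))
    rec₊ : ∀ j → ((one ⊕ mono (b (suc j)) 3) · laplace (W (index (suc j)))) ≈
      ((mono (p (suc j)) 3 · laplace (W (index j))) ⊕
       (mono (q (suc j)) 3 · laplace (W (index (suc (suc j))))))
    rec₊ j = O.trans
      (laplace-cubic (W (index (suc j))) (W (index (suc (suc j)))) (mono (p (suc j)) 3 · W (index j))
        (b (suc j)) (q (suc j)) low
        (λ i → trans (third′ (suc j) i)
          (sym (mono-3-· (p (suc j)) (W (index j)) i) ≡+ (q (suc j) * W (index (suc (suc j))) i))))
      (O.+-congʳ {mono (q (suc j)) 3 · laplace (W (index (suc (suc j))))}
        (laplace-mono-3 (p (suc j)) (W (index j))))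
      where
      low : ∀ i → i < 3 → W (index (suc j)) i ≡ (mono (p (suc j)) 3 · W (index j)) i
      low i i<3 = trans
        (vanishes (index (suc j)) i (ℕₚ.<-≤-trans i<3 (ℕₚ.m≤m+n 3 (index j))))
        (sym (vanishes-·ˡ (W (index j)) (vanishes-mono (p (suc j)) 3) i i<3))

-- The stated coefficients as ladder coefficients at exponent 3n + r

a₁≡ : ∀ n → a₁ n ≡ rising (+ (3 ℕ.* n) - + 3 + + 1) * falling (+ (3 ℕ.* n) + + 1)
a₁≡ n = identity (+ (3 ℕ.* n))
  where
  -- `3n` becomes a variable and `rising`, `falling` are unfolded so that the solver meets ring
  -- operations only.
  identity : ∀ u →
    (u + - + 2) * ((u + - + 1) * (u + - + 1)) * ((u + + 0) * (u + + 0)) * (u + + 1)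
    ≡ (u - + 3 + + 1) * (u - + 3 + + 1 + + 1) * (u - + 3 + + 1 + + 2)
      * ((u + + 1) * (u + + 1 - + 1) * (u + + 1 - + 2))
  identity = solve-∀

a₂≡ : ∀ n → a₂ n ≡ rising (+ (3 ℕ.* n) - + 3 + + 2) * falling (+ (3 ℕ.* n) + + 2)
a₂≡ n = identity (+ (3 ℕ.* n))
  where
  identity : ∀ u →
    (u + - + 1) * ((u + + 0) * (u + + 0)) * ((u + + 1) * (u + + 1)) * (u + + 2)
    ≡ (u - + 3 + + 2) * (u - + 3 + + 2 + + 1) * (u - + 3 + + 2 + + 2)
      * ((u + + 2) * (u + + 2 - + 1) * (u + + 2 - + 2))
  identity = solve-∀

a₃≡ : ∀ n → a₃ n ≡ rising (+ (3 ℕ.* n) - + 3 + + 3) * falling (+ (3 ℕ.* n) + + 3)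
a₃≡ n = identity (+ (3 ℕ.* n))
  where
  identity : ∀ u →
    (u + + 0) * ((u + + 1) * (u + + 1)) * ((u + + 2) * (u + + 2)) * (u + + 3)
    ≡ (u - + 3 + + 3) * (u - + 3 + + 3 + + 1) * (u - + 3 + + 3 + + 2)
      * ((u + + 3) * (u + + 3 - + 1) * (u + + 3 - + 2))
  identity = solve-∀

a₄≡ : ∀ n → a₄ n ≡ rising (+ (3 ℕ.* n) - + 3 + + 0 + + 1) * falling (+ (3 ℕ.* n) + + 0)
a₄≡ n = identity (+ (3 ℕ.* n))
  where
  identity : ∀ u →
    (u + - + 2) * (u + - + 2) * ((u + - + 1) * (u + - + 1)) * ((u + + 0) * (u + + 0))
    ≡ (u - + 3 + + 0 + + 1) * (u - + 3 + + 0 + + 1 + + 1) * (u - + 3 + + 0 + + 1 + + 2)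
      * ((u + + 0) * (u + + 0 - + 1) * (u + + 0 - + 2))
  identity = solve-∀

a₅≡ : ∀ n → a₅ n ≡ rising (+ (3 ℕ.* n) - + 3 + + 1 + + 1) * falling (+ (3 ℕ.* n) + + 1)
a₅≡ n = identity (+ (3 ℕ.* n))
  where
  identity : ∀ u →
    (u + - + 1) * (u + - + 1) * ((u + + 0) * (u + + 0)) * ((u + + 1) * (u + + 1))
    ≡ (u - + 3 + + 1 + + 1) * (u - + 3 + + 1 + + 1 + + 1) * (u - + 3 + + 1 + + 1 + + 2)
      * ((u + + 1) * (u + + 1 - + 1) * (u + + 1 - + 2))
  identity = solve-∀

a₆≡ : ∀ n → a₆ n ≡ rising (+ (3 ℕ.* n) - + 3 + + 2 + + 1) * falling (+ (3 ℕ.* n) + + 2)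
a₆≡ n = identity (+ (3 ℕ.* n))
  where
  identity : ∀ u →
    (u + + 0) * (u + + 0) * ((u + + 1) * (u + + 1)) * ((u + + 2) * (u + + 2))
    ≡ (u - + 3 + + 2 + + 1) * (u - + 3 + + 2 + + 1 + + 1) * (u - + 3 + + 2 + + 1 + + 2)
      * ((u + + 2) * (u + + 2 - + 1) * (u + + 2 - + 2))
  identity = solve-∀

b₄≡ : ∀ j → b₄ j ≡ middleSC (+ (3 ℕ.* j) + + 0)
b₄≡ j = identity (+ (3 ℕ.* j))
  where
  identity : ∀ z → (z + - + 1) * ((z + + 0) * (z + + 0)) + (z + + 1) * (z + + 1) * (z + + 2)
    ≡ (z + + 0 - + 1) * ((z + + 0) * (z + + 0)) + (z + + 0 + + 1) * (z + + 0 + + 1) * (z + + 0 + + 2)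
  identity = solve-∀

b₅≡ : ∀ j → b₅ j ≡ middleSC (+ (3 ℕ.* j) + + 1)
b₅≡ j = identity (+ (3 ℕ.* j))
  where
  identity : ∀ z → (z + + 0) * ((z + + 1) * (z + + 1)) + (z + + 2) * (z + + 2) * (z + + 3)
    ≡ (z + + 1 - + 1) * ((z + + 1) * (z + + 1)) + (z + + 1 + + 1) * (z + + 1 + + 1) * (z + + 1 + + 2)
  identity = solve-∀

b₆≡ : ∀ j → b₆ j ≡ middleSC (+ (3 ℕ.* j) + + 2)
b₆≡ j = identity (+ (3 ℕ.* j))
  where
  identity : ∀ z → (z + + 1) * ((z + + 2) * (z + + 2)) + (z + + 3) * (z + + 3) * (z + + 4)
    ≡ (z + + 2 - + 1) * ((z + + 2) * (z + + 2)) + (z + + 2 + + 1) * (z + + 2 + + 1) * (z + + 2 + + 2)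
  identity = solve-∀

-- Derivatives of sⁿ, sⁿc and sⁿc²

module E  = CommutativeRing exponential
module ER = SetoidReasoning E.setoid
module ES = SemiringSolver E.commutativeSemiring
module EP = RingProperties E.ring

const : ℕ → Series
const n = mono (+ n) 0

const-suc : ∀ n → const (suc n) ≈ (one ⊕ const n)
const-suc n zero    = refl
const-suc n (suc _) = refl

module SmCm (s c : Series) (s-0 : s 0 ≡ + 0) (c-0 : c 0 ≡ + 1)
  (s-suc : ∀ n → s (suc n) ≡ (c ⋆ c) n) (c-suc : ∀ n → c (suc n) ≡ - ((s ⋆ s) n)) where

  open ES using (solve; con; _:+_; _:*_; _:=_)

  cc c′ : Series
  cc = c ⋆ c
  c′ = E.- (s ⋆ s)

  ∂-cc : ∂ cc ≈ ((c′ ⋆ c) ⊕ (c ⋆ c′))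
  ∂-cc = E.trans (leibniz c c) (E.+-cong (E.*-congʳ {c} c-suc) (E.*-congˡ {c} c-suc))

  -- s³ + c³ = 1, free of subtraction so that its uses are semiring identities
  fermat : (c ⋆ cc) ≈ (one ⊕ (s ⋆ c′))
  fermat zero = begin
    + 1 * (c 0 * (+ 1 * (c 0 * c 0)))
      ≡⟨ cong (λ x → + 1 * (x * (+ 1 * (x * x)))) c-0 ⟩
    + 1
      ≡⟨ cong (λ x → + 1 + + 1 * (x * c′ 0)) s-0 ⟨
    + 1 + + 1 * (s 0 * c′ 0) ∎
  -- The values at 0 agree, and both sides have derivative `3c²c′`.
  fermat (suc n) = equal n
    where
    s·∂-c′ : (s ⋆ ∂ c′) ≈ (c′ ⋆ (cc ⊕ cc))
    s·∂-c′ = ER.begin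
      s ⋆ ∂ c′
        ER.≈⟨ E.*-congˡ {s} (E.-‿cong (E.trans (leibniz s s) (E.+-cong (E.*-congʳ {s} s-suc) (E.*-congˡ {s} s-suc)))) ⟩
      s ⋆ (E.- ((cc ⋆ s) ⊕ (s ⋆ cc)))
        ER.≈⟨ EP.-‿distribʳ-* s ((cc ⋆ s) ⊕ (s ⋆ cc)) ⟨
      E.- (s ⋆ ((cc ⋆ s) ⊕ (s ⋆ cc)))
        ER.≈⟨ E.-‿cong (solve 2 (λ s cc → s :* (cc :* s :+ s :* cc) := (s :* s) :* (cc :+ cc)) E.refl s cc) ⟩
      E.- ((s ⋆ s) ⋆ (cc ⊕ cc))
        ER.≈⟨ EP.-‿distribˡ-* (s ⋆ s) (cc ⊕ cc) ⟩
      c′ ⋆ (cc ⊕ cc) ER.∎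
    equal : ∂ (c ⋆ cc) ≈ ∂ (one ⊕ (s ⋆ c′))
    equal = ER.begin
      ∂ (c ⋆ cc)
        ER.≈⟨ leibniz c cc ⟩
      (∂ c ⋆ cc) ⊕ (c ⋆ ∂ cc)
        ER.≈⟨ E.+-cong (E.*-congʳ {cc} c-suc) (E.*-congˡ {c} ∂-cc) ⟩
      (c′ ⋆ cc) ⊕ (c ⋆ ((c′ ⋆ c) ⊕ (c ⋆ c′)))
        ER.≈⟨ solve 2 (λ c c′ → c′ :* (c :* c) :+ c :* (c′ :* c :+ c :* c′)
                := (c :* c) :* c′ :+ c′ :* (c :* c :+ c :* c)) E.refl c c′ ⟩
      (cc ⋆ c′) ⊕ (c′ ⋆ (cc ⊕ cc))
        ER.≈⟨ E.+-cong (E.*-congʳ {c′} s-suc) s·∂-c′ ⟨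
      (∂ s ⋆ c′) ⊕ (s ⋆ ∂ c′)
        ER.≈⟨ leibniz s c′ ⟨
      ∂ (s ⋆ c′)
        ER.≈⟨ (λ n → ℤₚ.+-identityˡ (∂ (s ⋆ c′) n)) ⟨
      ∂ (one ⊕ (s ⋆ c′)) ER.∎

  S SC SCC : ℕ → Series
  S zero    = one
  S (suc n) = S n ⋆ s
  SC  n = S n ⋆ c
  SCC n = S n ⋆ cc

  -- At `n = 0`, where `pred` truncates, the factor `const 0` annihilates both sides.
  const-S : ∀ n → (const n ⋆ (S (pred n) ⋆ s)) ≈ (const n ⋆ S n)
  const-S zero    i = trans (mono-zero-⋆ (+ 0) (S 0 ⋆ s) i) (sym (mono-zero-⋆ (+ 0) (S 0) i))
  const-S (suc n) i = refl

  ∂-S : ∀ n → ∂ (S n) ≈ (const n ⋆ SCC (pred n))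
  ∂-S zero    i = sym (mono-zero-⋆ (+ 0) (SCC 0) i)
  ∂-S (suc n) = ER.begin
    ∂ (S n ⋆ s)
      ER.≈⟨ leibniz (S n) s ⟩
    (∂ (S n) ⋆ s) ⊕ (S n ⋆ ∂ s)
      ER.≈⟨ E.+-cong (E.*-congʳ {s} (∂-S n)) (E.*-congˡ {S n} s-suc) ⟩
    ((const n ⋆ (S (pred n) ⋆ cc)) ⋆ s) ⊕ (S n ⋆ cc)
      ER.≈⟨ E.+-congʳ {S n ⋆ cc} (solve 4 (λ k p cc s → (k :* (p :* cc)) :* s := (k :* (p :* s)) :* cc)
              E.refl (const n) (S (pred n)) cc s) ⟩
    ((const n ⋆ (S (pred n) ⋆ s)) ⋆ cc) ⊕ (S n ⋆ cc)
      ER.≈⟨ E.+-congʳ {S n ⋆ cc} (E.*-congʳ {cc} (const-S n)) ⟩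
    ((const n ⋆ S n) ⋆ cc) ⊕ (S n ⋆ cc)
      ER.≈⟨ solve 3 (λ k p cc → (k :* p) :* cc :+ p :* cc := (con 1 :+ k) :* (p :* cc))
              E.refl (const n) (S n) cc ⟩
    (one ⊕ const n) ⋆ SCC n
      ER.≈⟨ E.*-congʳ {SCC n} (const-suc n) ⟨
    const (suc n) ⋆ SCC n ER.∎

  -- The reduction of `c³` that keeps the power of `c` below three and so closes the cycle of
  -- derivatives.
  const-S-fermat : ∀ n → (const n ⋆ (S (pred n) ⋆ (c ⋆ cc))) ≈ ((const n ⋆ S (pred n)) ⊕ ((const n ⋆ S n) ⋆ c′))
  const-S-fermat n = ER.begin
    k ⋆ (p ⋆ (c ⋆ cc))
      ER.≈⟨ E.*-congˡ {k} (E.*-congˡ {p} fermat) ⟩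
    k ⋆ (p ⋆ (one ⊕ (s ⋆ c′)))
      ER.≈⟨ solve 4 (λ k p s c′ → k :* (p :* (con 1 :+ s :* c′)) := k :* p :+ (k :* (p :* s)) :* c′)
              E.refl k p s c′ ⟩
    (k ⋆ p) ⊕ ((k ⋆ (p ⋆ s)) ⋆ c′)
      ER.≈⟨ E.+-congˡ {k ⋆ p} (E.*-congʳ {c′} (const-S n)) ⟩
    (k ⋆ p) ⊕ ((k ⋆ S n) ⋆ c′) ER.∎
    where
    k p : Series
    k = const n
    p = S (pred n)

  ∂-SC : ∀ n → ∂ (SC n) ≈ ((const n ⋆ S (pred n)) ⊕ (const (1 ℕ.+ n) ⋆ (S n ⋆ c′)))
  ∂-SC n = ER.begin
    ∂ (S n ⋆ c)
      ER.≈⟨ leibniz (S n) c ⟩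
    (∂ (S n) ⋆ c) ⊕ (S n ⋆ ∂ c)
      ER.≈⟨ E.+-cong (E.*-congʳ {c} (∂-S n)) (E.*-congˡ {S n} c-suc) ⟩
    ((k ⋆ (p ⋆ cc)) ⋆ c) ⊕ (S n ⋆ c′)
      ER.≈⟨ E.+-congʳ {S n ⋆ c′} (solve 4 (λ k p cc c → (k :* (p :* cc)) :* c := k :* (p :* (c :* cc)))
              E.refl k p cc c) ⟩
    (k ⋆ (p ⋆ (c ⋆ cc))) ⊕ (S n ⋆ c′)
      ER.≈⟨ E.+-congʳ {S n ⋆ c′} (const-S-fermat n) ⟩
    ((k ⋆ p) ⊕ ((k ⋆ S n) ⋆ c′)) ⊕ (S n ⋆ c′)
      ER.≈⟨ solve 4 (λ k p q c′ → (k :* p :+ (k :* q) :* c′) :+ q :* c′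
              := k :* p :+ (con 1 :+ k) :* (q :* c′)) E.refl k p (S n) c′ ⟩
    (k ⋆ p) ⊕ ((one ⊕ k) ⋆ (S n ⋆ c′))
      ER.≈⟨ E.+-congˡ {k ⋆ p} (E.*-congʳ {S n ⋆ c′} (const-suc n)) ⟨
    (k ⋆ p) ⊕ (const (1 ℕ.+ n) ⋆ (S n ⋆ c′)) ER.∎
    where
    k p : Series
    k = const n
    p = S (pred n)

  ∂-SCC : ∀ n → ∂ (SCC n) ≈ ((const n ⋆ SC (pred n)) ⊕ (const (2 ℕ.+ n) ⋆ (SC n ⋆ c′)))
  ∂-SCC n = ER.begin
    ∂ (S n ⋆ cc)
      -- Read as `(sⁿc)c`, the product inherits the reduction of `c³` from `∂-SC`.
      ER.≈⟨ (λ i → E.*-assoc (S n) c c (suc i)) ⟨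
    ∂ (SC n ⋆ c)
      ER.≈⟨ leibniz (SC n) c ⟩
    (∂ (SC n) ⋆ c) ⊕ (SC n ⋆ ∂ c)
      ER.≈⟨ E.+-cong (E.*-congʳ {c} (∂-SC n)) (E.*-congˡ {SC n} c-suc) ⟩
    (((k ⋆ p) ⊕ (k₁ ⋆ (S n ⋆ c′))) ⋆ c) ⊕ (SC n ⋆ c′)
      ER.≈⟨ solve 6 (λ k k₁ p q c c′ → (k :* p :+ k₁ :* (q :* c′)) :* c :+ (q :* c) :* c′
              := k :* (p :* c) :+ (con 1 :+ k₁) :* ((q :* c) :* c′)) E.refl k k₁ p (S n) c c′ ⟩
    (k ⋆ SC (pred n)) ⊕ ((one ⊕ k₁) ⋆ (SC n ⋆ c′))
      ER.≈⟨ E.+-congˡ {k ⋆ SC (pred n)} (E.*-congʳ {SC n ⋆ c′} (const-suc (suc n))) ⟨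
    (k ⋆ SC (pred n)) ⊕ (const (2 ℕ.+ n) ⋆ (SC n ⋆ c′)) ER.∎
    where
    k k₁ p : Series
    k  = const n
    k₁ = const (1 ℕ.+ n)
    p  = S (pred n)

  S⋆c′ : ∀ n → (S n ⋆ c′) ≈ (E.- S (2 ℕ.+ n))
  S⋆c′ n = ER.begin
    S n ⋆ (E.- (s ⋆ s))   ER.≈⟨ EP.-‿distribʳ-* (S n) (s ⋆ s) ⟨
    E.- (S n ⋆ (s ⋆ s))   ER.≈⟨ E.-‿cong (E.*-assoc (S n) s s) ⟨
    E.- S (2 ℕ.+ n)       ER.∎

  SC⋆c′ : ∀ n → (SC n ⋆ c′) ≈ (E.- SC (2 ℕ.+ n))
  SC⋆c′ n = ER.begin
    (S n ⋆ c) ⋆ c′          ER.≈⟨ solve 3 (λ q c c′ → (q :* c) :* c′ := (q :* c′) :* c) E.refl (S n) c c′ ⟩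
    (S n ⋆ c′) ⋆ c          ER.≈⟨ E.*-congʳ {c} (S⋆c′ n) ⟩
    (E.- S (2 ℕ.+ n)) ⋆ c   ER.≈⟨ EP.-‿distribˡ-* (S (2 ℕ.+ n)) c ⟨
    E.- SC (2 ℕ.+ n)        ER.∎

  S-suc : ∀ n i → S n (suc i) ≡ + n * SCC (pred n) i
  S-suc n i = trans (∂-S n i) (mono-zero-⋆ (+ n) (SCC (pred n)) i)

  difference : ∀ m n f {g} h → g ≈ (E.- h) → ∀ i →
    ((const m ⋆ f) ⊕ (const n ⋆ g)) i ≡ + m * f i - + n * h i
  difference m n f {g} h e i = begin
    (const m ⋆ f) i + (const n ⋆ g) i   ≡⟨ cong₂ _+_ (mono-zero-⋆ (+ m) f i) (mono-zero-⋆ (+ n) g i) ⟩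
    + m * f i + + n * g i               ≡⟨ (+ m * f i) +≡ cong (+ n *_) (e i) ⟩
    + m * f i + + n * - h i             ≡⟨ (+ m * f i) +≡ ℤₚ.neg-distribʳ-* (+ n) (h i) ⟨
    + m * f i - + n * h i               ∎

  SC-suc : ∀ n i → SC n (suc i) ≡ + n * S (pred n) i - + (1 ℕ.+ n) * S (2 ℕ.+ n) i
  SC-suc n i = trans (∂-SC n i) (difference n (1 ℕ.+ n) (S (pred n)) (S (2 ℕ.+ n)) (S⋆c′ n) i)

  SCC-suc : ∀ n i → SCC n (suc i) ≡ + n * SC (pred n) i - + (2 ℕ.+ n) * SC (2 ℕ.+ n) i
  SCC-suc n i = trans (∂-SCC n i) (difference n (2 ℕ.+ n) (SC (pred n)) (SC (2 ℕ.+ n)) (SC⋆c′ n) i)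

  S-0 : ∀ n → S (suc n) 0 ≡ + 0
  S-0 n = cong (+ 1 *_) (trans (cong (S n 0 *_) s-0) (ℤₚ.*-zeroʳ (S n 0)))

  SC-0 : ∀ n → SC (suc n) 0 ≡ + 0
  SC-0 n = cong (λ x → + 1 * (x * c 0)) (S-0 n)

  SCC-0 : ∀ n → SCC (suc n) 0 ≡ + 0
  SCC-0 n = cong (λ x → + 1 * (x * cc 0)) (S-0 n)

  SC-00 : SC 0 0 ≡ + 1
  SC-00 = cong (λ x → + 1 * (+ 1 * x)) c-0

  SCC-00 : SCC 0 0 ≡ + 1
  SCC-00 = cong (λ x → + 1 * (+ 1 * (+ 1 * (x * x)))) c-0

  S₁≈ : S 1 ≈ s
  S₁≈ = E.*-identityˡ s
  S₂≈ : S 2 ≈ (s ⋆ s)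
  S₂≈ = E.*-congʳ {s} S₁≈

-- The derivative cycle: orders of vanishing, third derivatives, initial values

module Cycle (S SC SCC : ℕ → Series)
  (S-suc   : ∀ n i → S n (suc i) ≡ + n * SCC (pred n) i)
  (SCC-suc : ∀ n i → SCC n (suc i) ≡ + n * SC (pred n) i - + (2 ℕ.+ n) * SC (2 ℕ.+ n) i)
  (SC-suc  : ∀ n i → SC n (suc i) ≡ + n * S (pred n) i - + (1 ℕ.+ n) * S (2 ℕ.+ n) i)
  (S-0 : ∀ n → S (suc n) 0 ≡ + 0) (SCC-0 : ∀ n → SCC (suc n) 0 ≡ + 0) (SC-0 : ∀ n → SC (suc n) 0 ≡ + 0)
  (S-00 : S 0 0 ≡ + 1) (SCC-00 : SCC 0 0 ≡ + 1) (SC-00 : SC 0 0 ≡ + 1) where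

  scaled-0 : ∀ x {y} → y ≡ + 0 → x * y ≡ + 0
  scaled-0 x refl = ℤₚ.*-zeroʳ x

  difference-0 : ∀ x z {y w} → y ≡ + 0 → w ≡ + 0 → x * y - z * w ≡ + 0
  difference-0 x z refl refl = cong₂ _-_ (ℤₚ.*-zeroʳ x) (ℤₚ.*-zeroʳ z)

  -- Mutual induction along the cycle: each derivative lowers the exponent by at most one, and terms
  -- with a raised exponent vanish to higher order still.
  S-vanishes   : ∀ n → Vanishes n (S n)
  SC-vanishes  : ∀ n → Vanishes n (SC n)
  SCC-vanishes : ∀ n → Vanishes n (SCC n)
  S-vanishes (suc n) zero    _         = S-0 n
  S-vanishes (suc n) (suc i) (s≤s i<n) = trans (S-suc (suc n) i)
    (scaled-0 (+ suc n) (SCC-vanishes n i i<n))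
  SC-vanishes (suc n) zero    _         = SC-0 n
  SC-vanishes (suc n) (suc i) (s≤s i<n) = trans (SC-suc (suc n) i)
    (difference-0 (+ suc n) (+ (2 ℕ.+ n)) (S-vanishes n i i<n)
      (S-vanishes (3 ℕ.+ n) i (ℕₚ.<-≤-trans i<n (ℕₚ.m≤n+m n 3))))
  SCC-vanishes (suc n) zero    _         = SCC-0 n
  SCC-vanishes (suc n) (suc i) (s≤s i<n) = trans (SCC-suc (suc n) i)
    (difference-0 (+ suc n) (+ (3 ℕ.+ n)) (SC-vanishes n i i<n)
      (SC-vanishes (3 ℕ.+ n) i (ℕₚ.<-≤-trans i<n (ℕₚ.m≤n+m n 3))))

  S-suc³ : ∀ n i → S n (3 ℕ.+ i) ≡
    + n * (+ pred n * (+ pred (pred n) * S (pred (pred (pred n))) i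
                       - + (1 ℕ.+ pred (pred n)) * S (2 ℕ.+ pred (pred n)) i)
          - + (2 ℕ.+ pred n) * (+ (2 ℕ.+ pred n) * S (1 ℕ.+ pred n) i
                       - + (3 ℕ.+ pred n) * S (4 ℕ.+ pred n) i))
  S-suc³ n i
    rewrite S-suc n (2 ℕ.+ i) | SCC-suc (pred n) (suc i)
          | SC-suc (pred (pred n)) i | SC-suc (2 ℕ.+ pred n) i = refl

  SC-suc³ : ∀ n i → SC n (3 ℕ.+ i) ≡
    + n * (+ pred n * (+ pred (pred n) * SC (pred (pred (pred n))) i
                       - + (2 ℕ.+ pred (pred n)) * SC (2 ℕ.+ pred (pred n)) i))
    - + (1 ℕ.+ n) * (+ (2 ℕ.+ n) * (+ (1 ℕ.+ n) * SC n i - + (3 ℕ.+ n) * SC (3 ℕ.+ n) i))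
  SC-suc³ n i
    rewrite SC-suc n (2 ℕ.+ i) | S-suc (pred n) (suc i) | S-suc (2 ℕ.+ n) (suc i)
          | SCC-suc (pred (pred n)) i | SCC-suc (1 ℕ.+ n) i = refl

  -- For `n < 3` the iterated `pred` truncates, but every term it distorts has coefficient 0. From 3
  -- on, `n = 3 + m` makes all exponents exact and a polynomial identity remains.
  S-third : ∀ n i → S n (3 ℕ.+ i) + middleS (+ n) * S n i ≡
    falling (+ n) * S (n ∸ 3) i + rising (+ n) * S (3 ℕ.+ n) i
  S-third 0 i = S-suc³ 0 i ≡+ + 0
  S-third 1 i = trans (S-suc³ 1 i ≡+ (+ 4 * S 1 i)) (identity (S 0 i) (S 1 i) (S 2 i) (S 4 i))
    where
    identity : ∀ u v w x → + 1 * (+ 0 * (+ 0 * u - + 1 * w) - + 2 * (+ 2 * v - + 3 * x)) + + 4 * v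
                         ≡ + 0 * u + + 6 * x
    identity = solve-∀
  S-third 2 i = trans (S-suc³ 2 i ≡+ (+ 20 * S 2 i)) (identity (S 0 i) (S 2 i) (S 5 i))
    where
    identity : ∀ u v x → + 2 * (+ 1 * (+ 0 * u - + 1 * v) - + 3 * (+ 3 * v - + 4 * x)) + + 20 * v
                         ≡ + 0 * u + + 24 * x
    identity = solve-∀
  S-third (suc (suc (suc m))) i =
    trans (S-suc³ (3 ℕ.+ m) i ≡+ (middleS (+ (3 ℕ.+ m)) * S (3 ℕ.+ m) i))
      (identity (+ m) (S m i) (S (3 ℕ.+ m) i) (S (6 ℕ.+ m) i))
    where
    identity : ∀ z u v w →
      (+ 3 + z) * ((+ 2 + z) * ((+ 1 + z) * u - (+ 2 + z) * v) - (+ 4 + z) * ((+ 4 + z) * v - (+ 5 + z) * w))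
        + + 2 * (+ 3 + z) * ((+ 3 + z) * (+ 3 + z) + + 1) * v
      ≡ (+ 3 + z) * (+ 3 + z - + 1) * (+ 3 + z - + 2) * u
        + (+ 3 + z) * (+ 3 + z + + 1) * (+ 3 + z + + 2) * w
    identity = solve-∀

  SC-third : ∀ n i → SC n (3 ℕ.+ i) + middleSC (+ n) * SC n i ≡
    falling (+ n) * SC (n ∸ 3) i + rising (+ n + + 1) * SC (3 ℕ.+ n) i
  SC-third 0 i = trans (SC-suc³ 0 i ≡+ (+ 2 * SC 0 i)) (identity (SC 0 i) (SC 3 i))
    where
    identity : ∀ u x → + 0 - + 1 * (+ 2 * (+ 1 * u - + 3 * x)) + + 2 * u ≡ + 0 + + 6 * x
    identity = solve-∀
  SC-third 1 i = trans (SC-suc³ 1 i ≡+ (+ 12 * SC 1 i)) (identity (SC 1 i) (SC 4 i))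
    where
    identity : ∀ v x → + 0 - + 2 * (+ 3 * (+ 2 * v - + 4 * x)) + + 12 * v ≡ + 0 + + 24 * x
    identity = solve-∀
  SC-third 2 i = trans (SC-suc³ 2 i ≡+ (+ 40 * SC 2 i)) (identity (SC 2 i) (SC 5 i))
    where
    identity : ∀ v x → + 2 * (+ 1 * (+ 0 - + 2 * v)) - + 3 * (+ 4 * (+ 3 * v - + 5 * x)) + + 40 * v
                     ≡ + 0 + + 60 * x
    identity = solve-∀
  SC-third (suc (suc (suc m))) i =
    trans (SC-suc³ (3 ℕ.+ m) i ≡+ (middleSC (+ (3 ℕ.+ m)) * SC (3 ℕ.+ m) i))
      (identity (+ m) (SC m i) (SC (3 ℕ.+ m) i) (SC (6 ℕ.+ m) i))
    where
    identity : ∀ z u v w →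
      (+ 3 + z) * ((+ 2 + z) * ((+ 1 + z) * u - (+ 3 + z) * v))
        - (+ 4 + z) * ((+ 5 + z) * ((+ 4 + z) * v - (+ 6 + z) * w))
        + ((+ 3 + z - + 1) * ((+ 3 + z) * (+ 3 + z)) + (+ 3 + z + + 1) * (+ 3 + z + + 1) * (+ 3 + z + + 2)) * v
      ≡ (+ 3 + z) * (+ 3 + z - + 1) * (+ 3 + z - + 2) * u
        + (+ 3 + z + + 1) * (+ 3 + z + + 1 + + 1) * (+ 3 + z + + 1 + + 2) * w
    identity = solve-∀

  S₁-low : ∀ i → i < 3 → S 1 i ≡ mono (+ 1) 1 i
  S₁-low 0 _ = S-0 0
  S₁-low 1 _ rewrite S-suc 1 0 | SCC-00 = refl
  S₁-low 2 _ rewrite S-suc 1 1 | SCC-suc 0 0 | SC-0 1 = refl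
  S₁-low (suc (suc (suc i))) (s≤s (s≤s (s≤s ())))

  S₂-low : ∀ i → i < 3 → S 2 i ≡ mono (+ 2) 2 i
  S₂-low 0 _ = S-0 1
  S₂-low 1 _ rewrite S-suc 2 0 | SCC-0 0 = refl
  S₂-low 2 _ rewrite S-suc 2 1 | SCC-suc 1 0 | SC-00 | SC-0 2 = refl
  S₂-low (suc (suc (suc i))) (s≤s (s≤s (s≤s ())))

  S₃-low : ∀ i → i < 3 → S 3 i ≡ mono (+ 6) 3 i
  S₃-low i i<3 = trans (S-vanishes 3 i i<3) (sym (vanishes-mono (+ 6) 3 i i<3))

  SC₀-low : ∀ i → i < 3 → SC 0 i ≡ mono (+ 1) 0 i
  SC₀-low 0 _ = SC-00
  SC₀-low 1 _ rewrite SC-suc 0 0 | S-0 1 = refl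
  SC₀-low 2 _ rewrite SC-suc 0 1 | S-suc 2 0 | SCC-0 0 = refl
  SC₀-low (suc (suc (suc i))) (s≤s (s≤s (s≤s ())))

  SC₁-low : ∀ i → i < 3 → SC 1 i ≡ mono (+ 1) 1 i
  SC₁-low 0 _ = SC-0 0
  SC₁-low 1 _ rewrite SC-suc 1 0 | S-00 | S-0 2 = refl
  SC₁-low 2 _ rewrite SC-suc 1 1 | S-suc 0 0 | S-suc 3 0 | SCC-0 1 = refl
  SC₁-low (suc (suc (suc i))) (s≤s (s≤s (s≤s ())))

  SC₂-low : ∀ i → i < 3 → SC 2 i ≡ mono (+ 2) 2 i
  SC₂-low 0 _ = SC-0 1
  SC₂-low 1 _ rewrite SC-suc 2 0 | S-0 0 | S-0 3 = refl
  SC₂-low 2 _ rewrite SC-suc 2 1 | S-suc 1 0 | SCC-00 | S-suc 4 0 | SCC-0 2 = refl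
  SC₂-low (suc (suc (suc i))) (s≤s (s≤s (s≤s ())))

mainTheorem1 : (s c : Series) → IsSmCm s c →
    JFracIs (mono (+ 1) 2) a₁ b₁ (laplace s)
    × JFracIs (mono (+ 2) 3) a₂ b₂ (laplace (s ⋆ s))
    × JFracIs (mono (+ 6) 4) a₃ b₃ (laplace ((s ⋆ s) ⋆ s))
    × JFracIs (mono (+ 1) 1) a₄ b₄ (laplace c)
    × JFracIs (mono (+ 1) 2) a₅ b₅ (laplace (s ⋆ c))
    × JFracIs (mono (+ 2) 3) a₆ b₆ (laplace ((s ⋆ s) ⋆ c))
mainTheorem1 s c (s-0 , c-0 , s-suc , c-suc) =
    S-ladder 1 (+ 1) 1 a₁ b₁ s S₁≈ S₁-low (λ _ → refl) (λ _ → refl) a₁≡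
  , S-ladder 2 (+ 2) 2 a₂ b₂ (s ⋆ s) S₂≈ S₂-low (λ _ → refl) (λ _ → refl) a₂≡
  , S-ladder 3 (+ 6) 3 a₃ b₃ ((s ⋆ s) ⋆ s) (E.*-congʳ {s} S₂≈) S₃-low
      -- The one start where `falling` is nonzero: `falling 3 = 6` and `S 0` is the constant 1,
      -- which yields the numerator `6x⁴`.
      (λ { zero → refl ; (suc _) → refl }) (λ _ → refl) a₃≡
  , SC-ladder 0 (+ 1) 0 a₄ b₄ c (E.*-identityˡ c) SC₀-low (λ _ → refl) b₄≡ a₄≡
  , SC-ladder 1 (+ 1) 1 a₅ b₅ (s ⋆ c) (E.*-congʳ {c} S₁≈) SC₁-low (λ _ → refl) b₅≡ a₅≡
  , SC-ladder 2 (+ 2) 2 a₆ b₆ ((s ⋆ s) ⋆ c) (E.*-congʳ {c} S₂≈) SC₂-low (λ _ → refl) b₆≡ a₆≡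
  where
  open SmCm s c s-0 c-0 s-suc c-suc
  open Cycle S SC SCC S-suc SCC-suc SC-suc S-0 SCC-0 SC-0 refl SCC-00 SC-00
  open Ladder S falling rising middleS S-third S-vanishes
    using () renaming (ladder to S-ladder)
  open Ladder SC falling (λ z → rising (z + + 1)) middleSC SC-third SC-vanishes
    using () renaming (ladder to SC-ladder)
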